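{- Let $k\ge1$ and let $w$ be an affine permutation (a nonzero element of the affine nil-Coxeter monoid $\hat{\mathbb A}_k$). If $w=d_{A_n}d_{A_{n-1}}\cdots d_{A_1}$ is a maximal expression for $w$ as a cyclically decreasing product, then $A_{i+1}\subset A_i-1$ for each $i$. In particular, $(|A_1|,|A_2|,\dots,|A_n|)$ is a partition.
   Context: Fix $k\ge1$ and let $I=\mathbb Z/(k+1)\mathbb Z$ (indices are taken mod $k+1$). The affine nil-Coxeter monoid $\hat{\mathbb A}_k$ is generated by $a_i$ ($i\in I$) and an absorbing zero $0$, with relations $a_i^2=0$, $a_ia_j=a_ja_i$ for $j\notin\{i-1,i,i+1\}$, and (for $k\ge2$) $a_ia_{i+1}a_i=a_{i+1}a_ia_{i+1}$. Its nonzero elements are identified with affine permutations in $\tilde S_{k+1}$ (the affine Coxeter group of type $A_k^{(1)}$ with generators $s_i$) by sending $a_{w_1}\cdots a_{w_l}$ to $s_{w_1}\cdots s_{w_l}$ for reduced words. For $A\subsetneq I$, $d_A$ is the product of the $a_i$, $i\in A$, each occurring once, ordered so that whenever $j,j-1\in A$ the letter $a_j$ is to the left of $a_{j-1}$. An expression $w=d_{A_n}\cdots d_{A_1}$ with all $A_i\subsetneq I$ nonempty is maximal if its shape $(|A_1|,\dots,|A_n|)$ is lexicographically maximal among all such expressions of $w$. For $S\subset I$, $S-1:=\{s-1: s\in S\}$. -}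

module Defs where

open import Data.Nat using (ℕ; suc; _+_; _≤_; _<_; _≥_)
open import Data.Nat.DivMod using (_mod_)
open import Data.Fin using (Fin; toℕ)
open import Data.Fin.Subset using (Subset; ∣_∣; ⊤; Nonempty; _⊂_) renaming (_∈_ to _∈ₛ_)
open import Data.List using (List; []; _∷_; [_]; _++_; map; concat; reverse)
open import Data.List.Membership.Propositional using (_∈_)
open import Data.List.Relation.Binary.Lex.Strict using (Lex-≤)
open import Data.List.Relation.Binary.Pointwise using (Pointwise)
open import Data.List.Relation.Unary.All using (All)
open import Data.List.Relation.Unary.Linked using (Linked)
open import Data.List.Relation.Unary.Unique.Propositional using (Unique)
open import Data.Product using (∃; ∃₂; _×_)
open import Function.Bundles using (_⇔_)
open import Level using (0ℓ)
open import Relation.Binary.PropositionalEquality using (_≡_; _≢_)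
open import Relation.Nullary using (¬_)
open import Relation.Unary using (Pred)

-- The index set ℤ/(k+1)ℤ.
I : ℕ → Set
I k = Fin (suc k)

next : ∀ {k} → I k → I k
next {k} i = (toℕ i + 1) mod suc k

-- k ≡ -1 modulo k+1
prev : ∀ {k} → I k → I k
prev {k} i = (toℕ i + k) mod suc k

-- The set S - 1 = { s - 1 : s ∈ S }.
shift : ∀ {k} → Subset (suc k) → Pred (I k) 0ℓ
shift S j = ∃ λ s → s ∈ₛ S × j ≡ prev s

data Gen (k : ℕ) : Set where
  𝟘 : Gen k
  a : I k → Gen k

-- Elements of the affine nil-Coxeter monoid are represented by words in the
-- generators, with the leftmost factor at the head of the list; equality in
-- the monoid is _≈_, and multiplication is _++_.
Word : ℕ → Set
Word k = List (Gen k)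

infix 4 _≈_ _≉𝟘

data _≈_ {k : ℕ} : Word k → Word k → Set where
  refl    : ∀ {u} → u ≈ u
  sym     : ∀ {u v} → u ≈ v → v ≈ u
  trans   : ∀ {u v w} → u ≈ v → v ≈ w → u ≈ w
  ++-cong : ∀ {u u′ v v′} → u ≈ u′ → v ≈ v′ → u ++ v ≈ u′ ++ v′
  zeroˡ   : ∀ x → 𝟘 ∷ x ∷ [] ≈ 𝟘 ∷ []
  zeroʳ   : ∀ x → x ∷ 𝟘 ∷ [] ≈ 𝟘 ∷ []
  square  : ∀ i → a i ∷ a i ∷ [] ≈ 𝟘 ∷ []
  commute : ∀ i j → j ≢ prev i → j ≢ i → j ≢ next i →
            a i ∷ a j ∷ [] ≈ a j ∷ a i ∷ []
  braid   : 2 ≤ k → ∀ i →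
            a i ∷ a (next i) ∷ a i ∷ [] ≈ a (next i) ∷ a i ∷ a (next i) ∷ []

_≉𝟘 : ∀ {k} → Word k → Set
w ≉𝟘 = ¬ (w ≈ [ 𝟘 ])

_isLeftOf_within_ : ∀ {k} → I k → I k → List (I k) → Set
i isLeftOf j within u = ∃₂ λ xs ys → u ≡ xs ++ i ∷ ys × j ∈ ys

-- The sequences of indices u for which the product of the a i, i in u, is
-- an admissible way of writing d_A.  All of them represent the same element.
record CyclicallyDecreasing {k : ℕ} (A : Subset (suc k)) (u : List (I k)) : Set where
  field
    unique  : Unique u
    letters : ∀ i → i ∈ u ⇔ i ∈ₛ A
    ordered : ∀ j → j ∈ₛ A → prev j ∈ₛ A → j isLeftOf (prev j) within u

-- IsExpression w (A₁ ∷ … ∷ Aₙ ∷ []) means w = d_{Aₙ} ⋯ d_{A₁}: the list is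
-- in order of the subscripts, hence the reversal in the product.
record IsExpression {k : ℕ} (w : Word k) (As : List (Subset (suc k))) : Set where
  field
    nonempty : All Nonempty As
    proper   : All (_⊂ ⊤) As
    factors  : List (List (I k))
    factor-d : Pointwise CyclicallyDecreasing As factors
    product  : w ≈ map a (concat (reverse factors))

shape : ∀ {n} → List (Subset n) → List ℕ
shape = map ∣_∣

record IsMaximalExpression {k : ℕ} (w : Word k) (As : List (Subset (suc k))) : Set where
  field
    isExpression : IsExpression w As
    maximal      : ∀ Bs → IsExpression w Bs → Lex-≤ _≡_ _<_ (shape Bs) (shape As)

IsPartition : List ℕ → Set
IsPartition ns = All (0 <_) ns × Linked _≥_ ns

{-# OPTIONS --safe #-}

-- Write B = A_{i+1} and A = A_i, and suppose b ∈ B but b + 1 ∉ A.  Let b, …, c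
-- be the run of B downwards from b, so that c - 1 ∉ B, and replace b by the last
-- element of the run whose successor is not in A; then b, …, c + 1 ∈ A.  Now
-- d_B ends with D = a_b ⋯ a_c and d_A begins with a_b ⋯ a_{c+1}.  The braid
-- relations give D a_b ⋯ a_{c+1} = a_{b-1} ⋯ a_c D.  If c ∈ A, it follows that
-- D D = 0, hence w = 0.  Otherwise d_B d_A = d_{B ∖ b} d_{A ∪ c}, which makes the
-- shape lexicographically larger.
module Submission where

open import Defs
open import Data.Nat using (ℕ; zero; suc; _+_; _≤_; _<_; z≤n; s≤s; _≤?_)
open import Data.Nat.DivMod using (_%_; m<n⇒m%n≡m; n%n≡0; [m+n]%n≡m%n)
open import Data.Nat.Properties
  using (≤-refl; ≤-trans; <-irrefl; <-trans; n<1+n; m<n⇒m<1+n; +-comm; +-suc)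
open import Data.Fin using (Fin; zero; suc; toℕ; fromℕ; inject₁)
open import Data.Fin.Induction using (<-weakInduction; >-weakInduction)
open import Data.Fin.Properties
  using (_≟_; any?; toℕ-fromℕ<; toℕ-fromℕ; toℕ-inject₁; toℕ-injective; toℕ<n; suc-injective)
open import Data.Fin.Relation.Unary.Top using (view; ‵fromℕ; ‵inject₁)
open import Data.Fin.Subset
  using (Subset; _∈_; _∉_; ∣_∣; ⊤; ⁅_⁆; _∪_; _-_; Nonempty; _⊂_; inside; outside)
open import Data.Fin.Subset.Properties
  using ( ∈⊤; ⊆⊤; p⊂q⇒∣p∣<∣q∣; x∈⁅x⁆; x∈⁅y⁆⇒x≡y; x∈p∪q⁻; x∈p∪q⁺; p⊆p∪q; x∈p∧x≢y⇒x∈p-y; p─q⊆p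
        ; x∈p⇒∣p-x∣<∣p∣; nonempty?)
  renaming (_∈?_ to _∈ₛ?_)
open import Data.List using (List; []; _∷_; [_]; _++_; map; concat; reverse)
import Data.List.Membership.DecPropositional as DecMembership
open import Data.List.Membership.Propositional using () renaming (_∈_ to _∈ₗ_; _∉_ to _∉ₗ_)
open import Data.List.Membership.Propositional.Properties using (∈-++⁺ˡ; ∈-++⁺ʳ; ∈-++⁻; ∈-map⁺)
open import Data.List.Properties
  using (++-assoc; ++-identityʳ; map-++; concat-++; concat-[_]; unfold-reverse)
open import Data.List.Relation.Binary.Lex.Strict using (Lex-≤; this) renaming (next to tie)
open import Data.List.Relation.Binary.Permutation.Propositional
  using (_↭_; prep; swap; ↭-refl; ↭-sym; ↭-trans)
open import Data.List.Relation.Binary.Permutation.Propositional.Properties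
  using (∈-resp-↭; All-resp-↭; ++-comm; ++⁺ʳ)
  renaming (shift to ↭-shift)
open import Data.List.Relation.Binary.Pointwise using (Pointwise; []; _∷_)
open import Data.List.Relation.Unary.All using (All; []; _∷_; tabulate; lookup) renaming (map to All-map)
open import Data.List.Relation.Unary.All.Properties using (++⁻ˡ; ++⁻ʳ)
  renaming (map⁺ to All-map⁺; ++⁺ to All-++⁺)
open import Data.List.Relation.Unary.AllPairs using (AllPairs; []; _∷_)
  renaming (map to AllPairs-map)
open import Data.List.Relation.Unary.AllPairs.Properties using () renaming (++⁺ to AllPairs-++⁺)
open import Data.List.Relation.Unary.Any using (here; there)
open import Data.List.Relation.Unary.Linked using (Linked; []; [-]; _∷_)
  renaming (map to Linked-map)
open import Data.List.Relation.Unary.Linked.Properties using () renaming (map⁺ to Linked-map⁺)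
open import Data.List.Relation.Unary.Unique.Propositional using (Unique)
open import Data.Product using (∃; ∃₂; _×_; _,_; proj₁; proj₂)
open import Data.Sum using (_⊎_; inj₁; inj₂; [_,_]′)
open import Data.Vec using ([]; _∷_; here; there)
open import Function using (_∘_)
open import Function.Bundles using (mk⇔; Equivalence)
open import Function.Definitions using (Injective)
open import Relation.Binary.Bundles using (Setoid)
open import Relation.Binary.PropositionalEquality as ≡ using (_≡_; _≢_; refl; cong; cong₂; subst)
import Relation.Binary.Reasoning.Setoid as SetoidReasoning
open import Relation.Nullary using (¬_; yes; no; contradiction; ¬?; _×-dec_; decidable-stable)
open import Relation.Unary using (_⊆_)

private
  variable
    k m n : ℕ
    b x y z : I k
    u v xs ys : List (I k)

module _ {k : ℕ} where
  open DecMembership (_≟_ {suc k}) public using (_∈?_)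

-- Arithmetic of ℤ/(k+1)ℤ

prev-zero : prev {k} zero ≡ fromℕ k
prev-zero {k} = toℕ-injective (≡.trans (toℕ-fromℕ< _)
  (≡.trans (m<n⇒m%n≡m (n<1+n k)) (≡.sym (toℕ-fromℕ k))))

prev-suc : (i : Fin k) → prev (suc i) ≡ inject₁ i
prev-suc {k} i = toℕ-injective (≡.trans (toℕ-fromℕ< _)
  (≡.trans (cong (_% suc k) (≡.sym (+-suc (toℕ i) k)))
  (≡.trans ([m+n]%n≡m%n (toℕ i) (suc k))
  (≡.trans (m<n⇒m%n≡m (m<n⇒m<1+n (toℕ<n i))) (≡.sym (toℕ-inject₁ i))))))

next-fromℕ : next (fromℕ k) ≡ zero
next-fromℕ {k} = toℕ-injective (≡.trans (toℕ-fromℕ< _)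
  (≡.trans (cong (_% suc k) (≡.trans (cong (_+ 1) (toℕ-fromℕ k)) (+-comm k 1)))
  (n%n≡0 (suc k))))

next-inject₁ : (i : Fin k) → next (inject₁ i) ≡ suc i
next-inject₁ {k} i = toℕ-injective (≡.trans (toℕ-fromℕ< _)
  (≡.trans (cong (_% suc k) (≡.trans (cong (_+ 1) (toℕ-inject₁ i)) (+-comm (toℕ i) 1)))
  (m<n⇒m%n≡m (s≤s (toℕ<n i)))))

next-prev : (i : I k) → next (prev i) ≡ i
next-prev zero    = ≡.trans (cong next prev-zero) next-fromℕ
next-prev (suc i) = ≡.trans (cong next (prev-suc i)) (next-inject₁ i)

prev-next : (i : I k) → prev (next i) ≡ i
prev-next i with view i
... | ‵fromℕ     = ≡.trans (cong prev next-fromℕ) prev-zero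
... | ‵inject₁ j = ≡.trans (cong prev (next-inject₁ j)) (prev-suc j)

next-injective : Injective _≡_ _≡_ (next {k})
next-injective {x = i} {j} e = ≡.trans (≡.sym (prev-next i)) (≡.trans (cong prev e) (prev-next j))

prev≢ : 1 ≤ k → (i : I k) → prev i ≢ i
prev≢ {suc k} _ zero    e with () ← ≡.trans (≡.sym prev-zero) e
prev≢ _ (suc i) e = <-irrefl
  (≡.trans (≡.sym (toℕ-inject₁ i)) (cong toℕ (≡.trans (≡.sym (prev-suc i)) e))) (n<1+n (toℕ i))

next≡prev : ¬ 2 ≤ k → (i : I k) → next i ≡ prev i
next≡prev {zero}        _   zero       = refl
next≡prev {suc zero}    _   zero       = refl
next≡prev {suc zero}    _   (suc zero) = refl
next≡prev {suc (suc k)} k<2 _          = contradiction (s≤s (s≤s z≤n)) k<2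

-- Induction around the circle from an arbitrary base point: `climb` carries `P` from `z` up to the
-- top of `Fin`, wraps to `zero` because `prev zero` is the top, and then reaches every index.
prev-induction : (P : I k → Set) → P z → (∀ i → P (prev i) → P i) → ∀ i → P i
prev-induction {z = z} P Pz climb = <-weakInduction P
  (climb zero (subst P (≡.sym prev-zero) (to-top z Pz)))
  (λ i → climb (suc i) ∘ subst P (≡.sym (prev-suc i)))
  where
  to-top : ∀ i → P i → P (fromℕ _)
  to-top = >-weakInduction (λ i → P i → P (fromℕ _)) (λ p → p)
    (λ i f → f ∘ climb (suc i) ∘ subst P (≡.sym (prev-suc i)))

x∉p-x : (p : Subset n) (i : Fin n) → i ∉ p - i
x∉p-x (_ ∷ p) (suc i) (there i∈) = x∉p-x p i i∈

-- Each element of `p` uses up its image in `q`; by injectivity the images of the remaining elements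
-- survive the removal, which lowers the size of `q`.
∣∣-injection : ∀ {m n} (f : Fin m → Fin n) → Injective _≡_ _≡_ f →
               (p : Subset m) (q : Subset n) → (∀ {i} → i ∈ p → f i ∈ q) → ∣ p ∣ ≤ ∣ q ∣
∣∣-injection f inj []            q f∈ = z≤n
∣∣-injection f inj (outside ∷ p) q f∈ = ∣∣-injection (f ∘ suc) (suc-injective ∘ inj) p q (f∈ ∘ there)
∣∣-injection f inj (inside ∷ p)  q f∈ = ≤-trans
  (s≤s (∣∣-injection (f ∘ suc) (suc-injective ∘ inj) p (q - f zero)
    λ i∈p → x∈p∧x≢y⇒x∈p-y (f∈ (there i∈p)) (λ e → contradiction (inj e) λ ())))
  (x∈p⇒∣p-x∣<∣p∣ (f∈ here))

-- Words without zero

infix 4 _≃_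

-- A wrapper, so that the lists of indices can be inferred.
record _≃_ (u v : List (I k)) : Set where
  constructor ⟨_⟩
  field words : map a u ≈ map a v

≃-setoid : ℕ → Setoid _ _
≃-setoid k = record
  { Carrier       = List (I k)
  ; _≈_           = _≃_
  ; isEquivalence = record
    { refl  = ⟨ refl ⟩
    ; sym   = λ { ⟨ p ⟩ → ⟨ sym p ⟩ }
    ; trans = λ { ⟨ p ⟩ ⟨ q ⟩ → ⟨ trans p q ⟩ }
    }
  }

module ≃-Reasoning {k} = SetoidReasoning (≃-setoid k)
module ≃ {k} = Setoid (≃-setoid k)

≡⇒≈ : {w w′ : Word k} → w ≡ w′ → w ≈ w′
≡⇒≈ refl = refl

≃-++ : {u u′ v v′ : List (I k)} → u ≃ u′ → v ≃ v′ → u ++ v ≃ u′ ++ v′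
≃-++ {u = u} {u′} {v} {v′} ⟨ p ⟩ ⟨ q ⟩ =
  ⟨ trans (≡⇒≈ (map-++ a u v)) (trans (++-cong p q) (≡⇒≈ (≡.sym (map-++ a u′ v′)))) ⟩

≃-++ˡ : ∀ (u : List (I k)) {v v′} → v ≃ v′ → u ++ v ≃ u ++ v′
≃-++ˡ u = ≃-++ {u = u} ≃.refl

≃-++ʳ : ∀ {u u′} (v : List (I k)) → u ≃ u′ → u ++ v ≃ u′ ++ v
≃-++ʳ v p = ≃-++ {v = v} p ≃.refl

Vanishes : List (I k) → Set
Vanishes u = map a u ≈ [ 𝟘 ]

zero-absorbsˡ : (w : Word k) → 𝟘 ∷ w ≈ [ 𝟘 ]
zero-absorbsˡ []      = refl
zero-absorbsˡ (g ∷ w) = trans (++-cong (zeroˡ g) refl) (zero-absorbsˡ w)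

zero-absorbsʳ : (w : Word k) → w ++ [ 𝟘 ] ≈ [ 𝟘 ]
zero-absorbsʳ []      = refl
zero-absorbsʳ (g ∷ w) = trans (++-cong {u = [ g ]} refl (zero-absorbsʳ w)) (zeroʳ g)

vanishes-++ˡ : ∀ (u : List (I k)) {v} → Vanishes v → Vanishes (u ++ v)
vanishes-++ˡ u {v} p =
  trans (≡⇒≈ (map-++ a u v)) (trans (++-cong {u = map a u} refl p) (zero-absorbsʳ (map a u)))

vanishes-++ʳ : ∀ {u} (v : List (I k)) → Vanishes u → Vanishes (u ++ v)
vanishes-++ʳ {u = u} v p =
  trans (≡⇒≈ (map-++ a u v)) (trans (++-cong {v = map a v} p refl) (zero-absorbsˡ (map a v)))

vanishes-resp : u ≃ v → Vanishes v → Vanishes u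
vanishes-resp ⟨ p ⟩ q = trans p q

Commuting : I k → I k → Set
Commuting i j = j ≢ prev i × j ≢ i × j ≢ next i

commute-letters : Commuting x y → x ∷ y ∷ u ≃ y ∷ x ∷ u
commute-letters {x = x} {y} {u} (p , q , r) = ≃-++ʳ u ⟨ commute x y p q r ⟩

commute-past : All (Commuting x) u → ∀ v → x ∷ u ++ v ≃ u ++ x ∷ v
commute-past                 []       v = ≃.refl
commute-past {u = y ∷ u} (p ∷ ps) v =
  ≃.trans (commute-letters p) (≃-++ˡ [ y ] (commute-past ps v))

-- Decreasing lists

-- The condition for `j` to stand to the right of `i`. Unlike `CyclicallyDecreasing`, this pairwise
-- form mentions no subset, so lists can be split and joined freely.
Precedes : I k → I k → Set
Precedes i j = j ≢ i × j ≢ next i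

Decreasing : List (I k) → Set
Decreasing = AllPairs Precedes

AllPairs-++⁻ : ∀ {A : Set} {R : A → A → Set} xs {ys} → AllPairs R (xs ++ ys) →
               AllPairs R xs × AllPairs R ys × All (λ x → All (R x) ys) xs
AllPairs-++⁻ []       d       = [] , d , []
AllPairs-++⁻ (x ∷ xs) (p ∷ d) with AllPairs-++⁻ xs d
... | d₁ , d₂ , q = (++⁻ˡ xs p ∷ d₁) , d₂ , (++⁻ʳ xs p ∷ q)

decreasing-disjoint : ∀ xs → Decreasing (xs ++ ys) → x ∈ₗ xs → x ∉ₗ ys
decreasing-disjoint xs d x∈xs x∈ys =
  proj₁ (lookup (lookup (proj₂ (proj₂ (AllPairs-++⁻ xs d))) x∈xs) x∈ys) refl

-- A letter to the left of `b` differs from `b` and `prev b` by the ordering and from `next b` by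
-- hypothesis, so `b` commutes past it. The permutation is recorded in order to transfer membership.
pullˡ : Decreasing u → b ∈ₗ u → next b ∉ₗ u →
        ∃ λ u′ → u ≃ b ∷ u′ × Decreasing (b ∷ u′) × u ↭ b ∷ u′
pullˡ {u = _ ∷ u} d (here refl) _ = u , ≃.refl , d , ↭-refl
pullˡ {u = y ∷ u} {b} (p ∷ d) (there b∈u) nb∉ with pullˡ d b∈u (nb∉ ∘ there)
... | u′ , eq , q ∷ d′ , perm with All-resp-↭ perm p
... | (b≢y , b≢ny) ∷ p′ =
  y ∷ u′
  , ≃.trans (≃-++ˡ [ y ] eq) (commute-letters
      ((λ b≡py → nb∉ (here (≡.trans (cong next b≡py) (next-prev y)))) , b≢y , b≢ny))
  , ((b≢y ∘ ≡.sym , λ y≡nb → nb∉ (here (≡.sym y≡nb))) ∷ q) ∷ p′ ∷ d′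
  , ↭-trans (prep y perm) (swap y b ↭-refl)

-- Mirror image of `pullˡ`: a letter to the right of `b` differs from `b` and `next b` by the
-- ordering and from `prev b` by hypothesis.
pullʳ : Decreasing v → b ∈ₗ v → prev b ∉ₗ v →
        ∃ λ v′ → v ≃ v′ ++ [ b ] × Decreasing (v′ ++ [ b ]) × v ↭ v′ ++ [ b ]
pullʳ {v = b ∷ v} (p ∷ d) (here refl) pb∉ =
  v
  , subst (λ u → b ∷ u ≃ v ++ [ b ]) (++-identityʳ v) (commute-past (tabulate comm) [])
  , AllPairs-++⁺ d ([] ∷ []) (tabulate λ x∈v → (before x∈v ∷ []))
  , ++-comm [ b ] v
  where
  x≢pb : ∀ {x} → x ∈ₗ v → x ≢ prev b
  x≢pb x∈v refl = pb∉ (there x∈v)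
  comm : ∀ {x} → x ∈ₗ v → Commuting b x
  comm x∈v = x≢pb x∈v , lookup p x∈v
  before : ∀ {x} → x ∈ₗ v → Precedes x b
  before x∈v = proj₁ (lookup p x∈v) ∘ ≡.sym
             , λ { refl → x≢pb x∈v (≡.sym (prev-next _)) }
pullʳ {v = y ∷ v} (p ∷ d) (there b∈v) pb∉ with pullʳ d b∈v (pb∉ ∘ there)
... | v′ , eq , d′ , perm =
  y ∷ v′ , ≃-++ˡ [ y ] eq , All-resp-↭ perm p ∷ d′ , prep y perm

-- Runs of consecutive letters

descending : I k → ℕ → List (I k)
descending b zero    = []
descending b (suc m) = b ∷ descending (prev b) m

-- The index `b - m`: it ends `descending b (suc m)`, not `descending b m`.
lowest : I k → ℕ → I k
lowest b zero    = b
lowest b (suc m) = lowest (prev b) m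

descending-∷ʳ : ∀ (b : I k) m → descending b (suc m) ≡ descending b m ++ [ lowest b m ]
descending-∷ʳ b zero    = refl
descending-∷ʳ b (suc m) = cong (b ∷_) (descending-∷ʳ (prev b) m)

map-next-descending : ∀ (b : I k) m → map next (descending (prev b) m) ≡ descending b m
map-next-descending b zero    = refl
map-next-descending b (suc m) = cong₂ _∷_ (next-prev b) (map-next-descending (prev b) m)

-- The length `m` is exact: `stop` requires the first letter after the run to be absent from `v`.
-- This makes `m` unique, which in turn prevents a run from wrapping round the circle.
data Run (v : List (I k)) : I k → ℕ → Set where
  stop : b ∉ₗ v → Run v b 0
  step : b ∈ₗ v → Run v (prev b) m → Run v b (suc m)

-- A downward walk ends at the missing letter `z` at the latest, so `z` serves as the base of the
-- cyclic induction.
run : z ∉ₗ v → ∀ b → ∃ (Run v b)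
run {v = v} z∉v = prev-induction _ (0 , stop z∉v) extend
  where
  extend : ∀ b → ∃ (Run v (prev b)) → ∃ (Run v b)
  extend b (m , r) with b ∈? v
  ... | yes b∈v = suc m , step b∈v r
  ... | no  b∉v = 0 , stop b∉v

run-unique : Run v b m → Run v b n → m ≡ n
run-unique (stop _)   (stop _)   = refl
run-unique (stop b∉)  (step b∈ _) = contradiction b∈ b∉
run-unique (step b∈ _) (stop b∉)  = contradiction b∈ b∉
run-unique (step _ r) (step _ s) = cong suc (run-unique r s)

run-contains : Run v b m → b ∈ₗ v → b ∈ₗ descending b m
run-contains (stop b∉)  b∈ = contradiction b∈ b∉
run-contains (step _ _) _  = here refl

run-from : Run v b m → x ∈ₗ descending b m → ∃ λ n → n < m × Run v x (suc n)
run-from r@(step _ _) (here refl) = _ , ≤-refl , r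
run-from (step _ r)   (there x∈) with run-from r x∈
... | n , n<m , s = n , m<n⇒m<1+n n<m , s

-- If the run reached `next b`, it would then pass through `b` again with fewer than `m` letters
-- left, against `run-unique`.
run-next : Run v b m → next b ∉ₗ descending b m
run-next {v = v} {b} r nb∈ with run-from r nb∈
... | n , n<m , step _ s =
  <-irrefl (run-unique (subst (λ i → Run v i n) (prev-next b) s) r) n<m

run-head : Run v b (suc m) → b ∉ₗ descending (prev b) m
run-head {b = b} (step _ r) = subst (_∉ₗ descending (prev b) _) (next-prev b) (run-next r)

-- The run is collected from its bottom: once the letters below `b` stand at the end, `prev b` does
-- not occur in front of them, so `pullʳ` can bring `b` up to them.
pull-runʳ : Decreasing v → Run v b m →
            ∃ λ v′ → v ≃ v′ ++ descending b m
                   × Decreasing (v′ ++ descending b m)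
                   × v ↭ v′ ++ descending b m
pull-runʳ {v = v} d (stop _) rewrite ≡.sym (++-identityʳ v) =
  v , ≃.refl , d , ↭-refl
pull-runʳ {v = v} {b} {suc m} d (step b∈v r) with pull-runʳ d r
... | v₁ , eq₁ , d₁ , perm₁ with AllPairs-++⁻ v₁ d₁
... | dv₁ , dD , cross with pullʳ dv₁ b∈v₁ pb∉v₁
  where
  D = descending (prev b) m
  b∈v₁ : b ∈ₗ v₁
  b∈v₁ = [ (λ p → p) , (λ b∈D → contradiction b∈D (run-head (step b∈v r))) ]′ (∈-++⁻ v₁ (∈-resp-↭ perm₁ b∈v))
  pb∉v₁ : prev b ∉ₗ v₁
  pb∉v₁ pb∈v₁ = decreasing-disjoint v₁ d₁ pb∈v₁
    (run-contains r (∈-resp-↭ (↭-sym perm₁) (∈-++⁺ˡ pb∈v₁)))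
... | v₂ , eq₂ , d₂ , perm₂ =
  v₂
  , subst (v ≃_) assoc (≃.trans eq₁ (≃-++ʳ D eq₂))
  , subst Decreasing assoc (AllPairs-++⁺ d₂ dD (All-resp-↭ perm₂ cross))
  , subst (v ↭_) assoc (↭-trans perm₁ (++⁺ʳ D perm₂))
  where
  D = descending (prev b) m
  assoc = ++-assoc v₂ [ b ] D

-- The letters are taken from the top: once `b` has been removed, the successor of `prev b` is
-- absent from the rest, so `prev b` can be pulled in turn.
pull-runˡ : Decreasing u → Decreasing (descending b m) → All (_∈ₗ u) (descending b m) → next b ∉ₗ u →
            ∃ λ u′ → u ≃ descending b m ++ u′
                   × Decreasing (descending b m ++ u′)
                   × u ↭ descending b m ++ u′
pull-runˡ {u = u} {m = zero} d _ _ _ = u , ≃.refl , d , ↭-refl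
pull-runˡ {b = b} {suc m} d (p ∷ dD) (b∈u ∷ D⊆u) nb∉u with pullˡ d b∈u nb∉u
... | u₁ , eq₁ , q ∷ d₁ , perm₁ with pull-runˡ d₁ dD (tabulate D⊆u₁) nb∉u₁
  where
  D⊆u₁ : ∀ {x} → x ∈ₗ descending (prev b) m → x ∈ₗ u₁
  D⊆u₁ x∈D with ∈-resp-↭ perm₁ (lookup D⊆u x∈D)
  ... | here x≡b   = contradiction x≡b (proj₁ (lookup p x∈D))
  ... | there x∈u₁ = x∈u₁
  nb∉u₁ : next (prev b) ∉ₗ u₁
  nb∉u₁ h = proj₁ (lookup q h) (next-prev b)
... | u₂ , eq₂ , d₂ , perm₂ =
  u₂ , ≃.trans eq₁ (≃-++ˡ [ b ] eq₂) , All-resp-↭ perm₂ q ∷ d₂ , ↭-trans perm₁ (prep b perm₂)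

run-commuting : Run v b (suc (suc m)) → All (Commuting b) (descending (prev (prev b)) m)
run-commuting r@(step _ s) = tabulate λ x∈ →
    (λ { refl → run-head s x∈ })
  , (λ { refl → run-head r (there x∈) })
  , (λ { refl → run-next r (there (there x∈)) })

braid-letters : Run v b (suc (suc m)) → ∀ u → b ∷ prev b ∷ b ∷ u ≃ prev b ∷ b ∷ prev b ∷ u
braid-letters {k} {b = b} r u = ≃-++ʳ u ⟨ sym braided ⟩
  where
  2≤k : 2 ≤ k
  2≤k with 2 ≤? k
  ... | yes p = p
  -- For `k < 2` the indices `next b` and `prev b` coincide, so a run of length at least two would
  -- contain `next b`.
  ... | no  p = contradiction (there (here (next≡prev p b))) (run-next r)
  braided : map a (prev b ∷ b ∷ prev b ∷ []) ≈ map a (b ∷ prev b ∷ b ∷ [])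
  braided = subst (λ i → map a (prev b ∷ i ∷ prev b ∷ []) ≈ map a (i ∷ prev b ∷ i ∷ []))
    (next-prev b) (braid 2≤k (prev b))

-- Conjugation by a_b ⋯ a_c lowers the indices b, …, c + 1 by one.
descending-exchange : Run v b (suc m) →
  descending b (suc m) ++ descending b m ≃ descending (prev b) m ++ descending b (suc m)
descending-exchange {m = zero}              r            = ≃.refl
descending-exchange {b = b} {m = suc n} r@(step _ s) = begin
  -- The braid brings `b′` to the front and leaves the same exchange one index lower. Since `b`
  -- commutes with every letter of `E`, it is moved left before the braid and right again at the
  -- end.
  b ∷ b′ ∷ E ++ b ∷ D      ≈⟨ ≃-++ˡ (b ∷ b′ ∷ []) (commute-past (run-commuting r) D) ⟨
  b ∷ b′ ∷ b ∷ E ++ D      ≈⟨ braid-letters r (E ++ D) ⟩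
  b′ ∷ b ∷ b′ ∷ E ++ D     ≈⟨ ≃-++ˡ (b′ ∷ b ∷ []) (descending-exchange s) ⟩
  b′ ∷ b ∷ E ++ b′ ∷ E     ≈⟨ ≃-++ˡ [ b′ ] (commute-past (run-commuting r) (b′ ∷ E)) ⟩
  b′ ∷ E ++ b ∷ b′ ∷ E     ∎
  where
  open ≃-Reasoning
  b′ = prev b
  D  = descending b′ n
  E  = descending (prev b′) n

-- With the last letter `c` of the second copy set aside, the exchange turns the rest into a word
-- that also ends in `c`, and `c c` vanishes.
descending-square : Run v b (suc m) → Vanishes (descending b (suc m) ++ descending b (suc m))
descending-square {v = v} {b} {m} r = vanishes-resp eq
  (vanishes-++ˡ E (vanishes-++ˡ D (square c)))
  where
  open ≃-Reasoning
  c = lowest b m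
  D = descending b m
  E = descending (prev b) m
  eq : (b ∷ E) ++ (b ∷ E) ≃ E ++ D ++ c ∷ c ∷ []
  eq = begin
    (b ∷ E) ++ (b ∷ E)          ≡⟨ cong ((b ∷ E) ++_) (descending-∷ʳ b m) ⟩
    (b ∷ E) ++ D ++ [ c ]       ≡⟨ ++-assoc (b ∷ E) D [ c ] ⟨
    ((b ∷ E) ++ D) ++ [ c ]     ≈⟨ ≃-++ʳ [ c ] (descending-exchange r) ⟩
    (E ++ b ∷ E) ++ [ c ]       ≡⟨ ++-assoc E (b ∷ E) [ c ] ⟩
    E ++ (b ∷ E) ++ [ c ]       ≡⟨ cong (λ u → E ++ u ++ [ c ]) (descending-∷ʳ b m) ⟩
    E ++ (D ++ [ c ]) ++ [ c ]  ≡⟨ cong (E ++_) (++-assoc D [ c ] [ c ]) ⟩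
    E ++ D ++ c ∷ c ∷ []        ∎

-- Moving a letter to the right

-- In `improve`, `lost` is the top of a run and `gained` its bottom, so the letter that moves may
-- change its index. The field `gap` keeps the letters of the enlarged right factor a proper subset.
record Improvement (v u : List (I k)) : Set where
  field
    {lost gained gap} : I k
    {left right}      : List (I k)
    left-decreasing   : Decreasing left
    right-decreasing  : Decreasing right
    left-letters      : v ↭ lost ∷ left
    right-letters     : right ↭ gained ∷ u
    lost∉             : lost ∉ₗ left
    gained∉           : gained ∉ₗ u
    gap∉              : gap ∉ₗ right
    equal             : v ++ u ≃ left ++ right

-- Of the letters in the run of v below top, only the lowest may be absent from u.
record Obstruction (v u : List (I k)) : Set where
  field
    {top}    : I k
    {length} : ℕ
    top-run  : Run v top (suc length)
    covered  : All (_∈ₗ u) (descending top length)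
    gap      : next top ∉ₗ u

-- The recursive call comes first, so the run is searched from its bottom and the obstruction found
-- is at the lowest letter whose successor is absent from `u`.
scan : ∀ (u : List (I k)) → Run v b m →
       Obstruction v u ⊎ All (λ x → next x ∈ₗ u) (descending b m)
scan u (stop _) = inj₂ []
scan {b = b} u (step b∈v r) with scan u r
... | inj₁ o = inj₁ o
... | inj₂ good with next b ∈? u
...   | yes nb∈u = inj₂ (nb∈u ∷ good)
...   | no  nb∉u = inj₁ record
  { top-run = step b∈v r
  -- Here `good` concerns the successors of the letters below `b`; these form the run from `b`
  -- without its lowest letter.
  ; covered = subst (All (_∈ₗ u)) (map-next-descending b _) (All-map⁺ good)
  ; gap     = nb∉u
  }

obstruction : z ∉ₗ v → b ∈ₗ v → next b ∉ₗ u → Obstruction v u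
obstruction {b = b} {u} z∉v b∈v nb∉u with run z∉v b
... | _ , stop b∉v = contradiction b∈v b∉v
... | _ , r@(step _ _) with scan u r
...   | inj₁ o          = o
...   | inj₂ (nb∈u ∷ _) = contradiction nb∈u nb∉u

improve : Decreasing v → Decreasing u → Obstruction v u → Vanishes (v ++ u) ⊎ Improvement v u
improve {v = v} {u} dv du record { top = b ; length = m ; top-run = r ; covered = D⊆u ; gap = nb∉u }
  with pull-runʳ dv r
... | X , v≃ , dX , v↭ with AllPairs-++⁻ X dX
... | dX₁ , d⁺ , crossX with subst Decreasing (descending-∷ʳ b m) d⁺ | lowest b m ∈? u
-- With `c` in `u`, the whole run can be brought to the front of `u`, where it meets its copy at the
-- end of `v`.
... | dDc | yes c∈u with pull-runˡ du d⁺ D⁺⊆u nb∉u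
  where
  D⁺⊆u = subst (All (_∈ₗ u)) (≡.sym (descending-∷ʳ b m)) (All-++⁺ D⊆u (c∈u ∷ []))
... | Y , u≃ , _ , _ = inj₁ (vanishes-resp eq
  (vanishes-++ˡ X (vanishes-++ʳ Y (descending-square r))))
  where
  open ≃-Reasoning
  D⁺ = descending b (suc m)
  eq : v ++ u ≃ X ++ (D⁺ ++ D⁺) ++ Y
  eq = begin
    v ++ u                  ≈⟨ ≃-++ v≃ u≃ ⟩
    (X ++ D⁺) ++ D⁺ ++ Y    ≡⟨ ++-assoc X D⁺ (D⁺ ++ Y) ⟩
    X ++ D⁺ ++ D⁺ ++ Y      ≡⟨ cong (X ++_) (++-assoc D⁺ D⁺ Y) ⟨
    X ++ (D⁺ ++ D⁺) ++ Y    ∎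
improve {v = v} {u} dv du record { top = b ; length = m ; top-run = r ; covered = D⊆u ; gap = nb∉u }
  | X , v≃ , dX , v↭ | dX₁ , d⁺ , crossX | dDc | no c∉u
  with pull-runˡ du (proj₁ (AllPairs-++⁻ (descending b m) dDc)) D⊆u nb∉u
-- The new factors are `X ++ E` and `D⁺ ++ Y`: the exchange drops `b` on the left and adds `c` on
-- the right.
... | Y , u≃ , dDY , u↭ = inj₂ record
  { left-decreasing  = AllPairs-++⁺ dX₁ (dE d⁺) (All-map (λ { (_ ∷ p) → p }) crossX)
  ; right-decreasing = AllPairs-++⁺ d⁺ (proj₁ (proj₂ (AllPairs-++⁻ D dDY)))
                         (tabulate λ x∈ → tabulate (before x∈))
  ; left-letters     = ↭-trans v↭ (↭-shift b X E)
  ; right-letters    = right↭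
  ; lost∉            = b∉left
  ; gained∉          = c∉u
  ; gap∉             = nb∉right
  ; equal            = equal
  }
  where
  c = lowest b m
  D = descending b m
  D⁺ = descending b (suc m)
  E = descending (prev b) m

  dE : Decreasing D⁺ → Decreasing E
  dE (_ ∷ d) = d

  Y⊆u : x ∈ₗ Y → x ∈ₗ u
  Y⊆u = ∈-resp-↭ (↭-sym u↭) ∘ ∈-++⁺ʳ D

  split : x ∈ₗ D⁺ → x ∈ₗ D ⊎ x ≡ c
  split x∈ with ∈-++⁻ D (subst (_ ∈ₗ_) (descending-∷ʳ b m) x∈)
  ... | inj₁ x∈D         = inj₁ x∈D
  ... | inj₂ (here x≡c) = inj₂ x≡c

  -- Lowering the indices of `D` by one gives `E`, so only the top letter `b` can have its successor
  -- outside `D`; that successor is the gap.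
  next∈ : x ∈ₗ D⁺ → x ≡ b ⊎ next x ∈ₗ D
  next∈ (here x≡b) = inj₁ x≡b
  next∈ (there x∈E) = inj₂ (subst (_ ∈ₗ_) (map-next-descending b m) (∈-map⁺ next x∈E))

  before : x ∈ₗ D⁺ → y ∈ₗ Y → Precedes x y
  before x∈ y∈ = (λ { refl → x∉Y y∈ }) , (λ { refl → nx∉Y y∈ })
    where
    x∉Y : _ ∉ₗ Y
    x∉Y x∈Y with split x∈
    ... | inj₁ x∈D  = decreasing-disjoint D dDY x∈D x∈Y
    ... | inj₂ refl = c∉u (Y⊆u x∈Y)
    nx∉Y : _ ∉ₗ Y
    nx∉Y nx∈Y with next∈ x∈
    ... | inj₁ refl  = nb∉u (Y⊆u nx∈Y)
    ... | inj₂ nx∈D = decreasing-disjoint D dDY nx∈D nx∈Y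

  b∉left : b ∉ₗ X ++ E
  b∉left h with ∈-++⁻ X h
  ... | inj₁ b∈X = decreasing-disjoint X dX b∈X (here refl)
  ... | inj₂ b∈E = run-head r b∈E

  right↭ : D⁺ ++ Y ↭ c ∷ u
  right↭ = subst (_↭ c ∷ u)
    (≡.sym (≡.trans (cong (_++ Y) (descending-∷ʳ b m)) (++-assoc D [ c ] Y)))
    (↭-trans (↭-shift c D Y) (prep c (↭-sym u↭)))

  nb∉right : next b ∉ₗ D⁺ ++ Y
  nb∉right h with ∈-++⁻ D⁺ h
  ... | inj₁ h∈D = run-next r h∈D
  ... | inj₂ h∈Y = nb∉u (Y⊆u h∈Y)

  open ≃-Reasoning
  equal : v ++ u ≃ (X ++ E) ++ D⁺ ++ Y
  equal = begin
    v ++ u                 ≈⟨ ≃-++ v≃ u≃ ⟩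
    (X ++ D⁺) ++ D ++ Y    ≡⟨ ++-assoc X D⁺ (D ++ Y) ⟩
    X ++ D⁺ ++ D ++ Y      ≡⟨ cong (X ++_) (++-assoc D⁺ D Y) ⟨
    X ++ (D⁺ ++ D) ++ Y    ≈⟨ ≃-++ˡ X (≃-++ʳ Y (descending-exchange r)) ⟩
    X ++ (E ++ D⁺) ++ Y    ≡⟨ cong (X ++_) (++-assoc E D⁺ Y) ⟩
    X ++ E ++ D⁺ ++ Y      ≡⟨ ++-assoc X E (D⁺ ++ Y) ⟨
    (X ++ E) ++ D⁺ ++ Y    ∎

-- Cyclically decreasing products

isLeftOf-tail : ∀ {i j : I k} → i isLeftOf j within (x ∷ u) → j ∈ₗ u
isLeftOf-tail ([]     , _ , refl , j∈) = j∈
isLeftOf-tail (_ ∷ xs , _ , refl , j∈) = ∈-++⁺ʳ xs (there j∈)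

decreasing : {A : Subset (suc k)} → CyclicallyDecreasing A u → Decreasing u
decreasing {u = u} cd = from-order unique λ j j∈ pj∈ →
  ordered j (Equivalence.to (letters j) j∈) (Equivalence.to (letters (prev j)) pj∈)
  where
  open CyclicallyDecreasing cd
  from-order : ∀ {k} {u : List (I k)} → Unique u →
               (∀ j → j ∈ₗ u → prev j ∈ₗ u → j isLeftOf (prev j) within u) → Decreasing u
  from-order []                   _   = []
  from-order {u = x ∷ u} (p ∷ un) ord = tabulate precedes ∷ from-order un ord′
    where
    precedes : ∀ {y} → y ∈ₗ u → Precedes x y
    -- If `next x` came later, `ordered` would place `x` to the right of it, giving a second
    -- occurrence of `x`.
    precedes y∈u = lookup p y∈u ∘ ≡.sym , λ { refl →
      lookup p (isLeftOf-tail (ord (next x) (there y∈u) (here (prev-next x)))) (≡.sym (prev-next x)) }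
    ord′ : ∀ j → j ∈ₗ u → prev j ∈ₗ u → j isLeftOf (prev j) within u
    ord′ j j∈ pj∈ with ord j (there j∈) (there pj∈)
    ... | []     , ys , refl , _    = contradiction refl (lookup p j∈)
    ... | _ ∷ xs , ys , refl , pj∈′ = xs , ys , refl , pj∈′

-- The bound `1 ≤ k` separates `prev j` from `j`; for `k = 0`, `ordered` would ask for two copies of
-- the same letter.
cyclicallyDecreasing : {A : Subset (suc k)} → 1 ≤ k → Decreasing u →
                       (∀ i → i ∈ₗ u → i ∈ A) → (∀ i → i ∈ A → i ∈ₗ u) →
                       CyclicallyDecreasing A u
cyclicallyDecreasing 1≤k d to from = record
  { unique  = AllPairs-map (λ p → proj₁ p ∘ ≡.sym) d
  ; letters = λ i → mk⇔ (to i) (from i)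
  ; ordered = λ j j∈ pj∈ → order d (from j j∈) (from (prev j) pj∈)
  }
  where
  order : ∀ {j u} → Decreasing u → j ∈ₗ u → prev j ∈ₗ u → j isLeftOf (prev j) within u
  order {j} d (here refl) (here e)      = contradiction e (prev≢ 1≤k j)
  order d (here refl) (there pj∈)       = [] , _ , refl , pj∈
  order {j} (p ∷ d) (there j∈) (here refl) = contradiction (≡.sym (next-prev j)) (proj₂ (lookup p j∈))
  order {u = x ∷ _} (p ∷ d) (there j∈) (there pj∈) with order d j∈ pj∈
  ... | xs , ys , refl , h = x ∷ xs , ys , refl , h

product : List (List (I k)) → List (I k)
product fs = concat (reverse fs)

product-∷ : ∀ (f : List (I k)) fs → product (f ∷ fs) ≡ product fs ++ f
product-∷ f fs =
  ≡.trans (cong concat (unfold-reverse f fs))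
  (≡.trans (≡.sym (concat-++ (reverse fs) [ f ])) (cong (product fs ++_) concat-[ f ]))

ExpressionOf : List (I k) → List (Subset (suc k)) → Set
ExpressionOf u = IsExpression (map a u)

-- The list of subsets runs by subscript, so its new head is the rightmost factor of the product.
expression-∷ : ∀ {A : Subset (suc k)} {As} → Nonempty A → A ⊂ ⊤ → CyclicallyDecreasing A u →
               ExpressionOf v As → ExpressionOf (v ++ u) (A ∷ As)
expression-∷ {u = u} {v} ne pr cd e = record
  { nonempty = ne ∷ nonempty
  ; proper   = pr ∷ proper
  ; factors  = u ∷ factors
  ; factor-d = cd ∷ factor-d
  ; product  = trans (_≃_.words (≃-++ {v = u} ⟨ eq ⟩ ≃.refl))
                 (≡⇒≈ (cong (map a) (≡.sym (product-∷ u factors))))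
  }
  where open IsExpression e renaming (product to eq)

expression-resp : ∀ {w w′ : Word k} {As} → w ≈ w′ → IsExpression w′ As → IsExpression w As
expression-resp w≈ e = record { IsExpression e; product = trans w≈ (IsExpression.product e) }

-- The left factor may lose its only letter; it is then omitted.
expression-improve : 1 ≤ k → {A B : Subset (suc k)} {Cs : List (Subset (suc k))} →
  A ⊂ ⊤ → B ⊂ ⊤ → CyclicallyDecreasing A u → CyclicallyDecreasing B v →
  Improvement v u → ∀ {t} → ExpressionOf t Cs →
  ∃₂ λ A′ Ds → ∣ A ∣ < ∣ A′ ∣ × ExpressionOf ((t ++ v) ++ u) (A′ ∷ Ds)
expression-improve {u = u} {v} 1≤k {A} {B} {Cs} A⊂ (_ , z , _ , z∉B) cdA cdB imp {t} e =
  A′ , proj₁ withLeft , p⊂q⇒∣p∣<∣q∣ A⊂A′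
  , expression-resp eq (expression-∷ (gained , gained∈A′) (⊆⊤ , gap , ∈⊤ , gap∉ ∘ fromA gap) cdA′
      (proj₂ withLeft))
  where
  open Improvement imp
  module A = CyclicallyDecreasing cdA
  module B = CyclicallyDecreasing cdB
  A′ = A ∪ ⁅ gained ⁆
  B′ = B - lost

  gained∈A′ : gained ∈ A′
  gained∈A′ = x∈p∪q⁺ (inj₂ (x∈⁅x⁆ gained))

  A⊂A′ : A ⊂ A′
  A⊂A′ = p⊆p∪q ⁅ gained ⁆ , gained , gained∈A′ , gained∉ ∘ Equivalence.from (A.letters gained)

  toA : ∀ i → i ∈ₗ right → i ∈ A′
  toA i i∈ with ∈-resp-↭ right-letters i∈
  ... | here refl = gained∈A′
  ... | there i∈u = p⊆p∪q _ (Equivalence.to (A.letters i) i∈u)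
  fromA : ∀ i → i ∈ A′ → i ∈ₗ right
  fromA i i∈ = ∈-resp-↭ (↭-sym right-letters) (cases (x∈p∪q⁻ A ⁅ gained ⁆ i∈))
    where
    cases : i ∈ A ⊎ i ∈ ⁅ gained ⁆ → i ∈ₗ gained ∷ u
    cases (inj₁ i∈A) = there (Equivalence.from (A.letters i) i∈A)
    cases (inj₂ i∈g) = here (x∈⁅y⁆⇒x≡y gained i∈g)

  cdA′ : CyclicallyDecreasing A′ right
  cdA′ = cyclicallyDecreasing 1≤k right-decreasing toA fromA

  toB : ∀ i → i ∈ₗ left → i ∈ B′
  toB i i∈ = x∈p∧x≢y⇒x∈p-y
    (Equivalence.to (B.letters i) (∈-resp-↭ (↭-sym left-letters) (there i∈)))
    λ { refl → lost∉ i∈ }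
  fromB : ∀ i → i ∈ B′ → i ∈ₗ left
  fromB i i∈ with ∈-resp-↭ left-letters (Equivalence.from (B.letters i) (p─q⊆p B ⁅ lost ⁆ i∈))
  ... | here refl   = contradiction i∈ (x∉p-x B lost)
  ... | there i∈′ = i∈′

  cdB′ : CyclicallyDecreasing B′ left
  cdB′ = cyclicallyDecreasing 1≤k left-decreasing toB fromB

  withLeft : ∃ (ExpressionOf (t ++ left))
  withLeft with nonempty? B′
  ... | yes ne = B′ ∷ Cs , expression-∷ ne (⊆⊤ , z , ∈⊤ , z∉B ∘ p─q⊆p B ⁅ lost ⁆) cdB′ e
  ... | no  em = Cs , subst (λ l → ExpressionOf (t ++ l) Cs) (≡.sym left≡[])
                        (subst (λ l → ExpressionOf l Cs) (≡.sym (++-identityʳ t)) e)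
    where
    left≡[] : left ≡ []
    left≡[] with left | toB
    ... | []    | _   = refl
    ... | i ∷ _ | to′ = contradiction (i , to′ i (here refl)) em

  eq : map a ((t ++ v) ++ u) ≈ map a ((t ++ left) ++ right)
  eq = _≃_.words (begin
    (t ++ v) ++ u         ≡⟨ ++-assoc t v u ⟩
    t ++ v ++ u           ≈⟨ ≃-++ˡ t equal ⟩
    t ++ left ++ right    ≡⟨ ++-assoc t left right ⟨
    (t ++ left) ++ right  ∎)
    where open ≃-Reasoning

-- Nesting along a whole expression

infix 4 _⊆-1+_

-- Equivalent to inclusion in `shift A`, but without the existential, so a failure is directly a
-- letter `b` with `next b` outside `A`.
_⊆-1+_ : Subset (suc k) → Subset (suc k) → Set
B ⊆-1+ A = ∀ i → i ∈ B → next i ∈ A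

contained? : (A B : Subset (suc k)) → B ⊆-1+ A ⊎ ∃ λ b → b ∈ B × next b ∉ A
contained? A B with any? (λ i → (i ∈ₛ? B) ×-dec ¬? (next i ∈ₛ? A))
... | yes misplaced = inj₂ misplaced
... | no  none      = inj₁ λ i i∈B →
  decidable-stable (next i ∈ₛ? A) λ ni∉A → none (i , i∈B , ni∉A)

NotDominated : List (Subset n) → List (Subset n) → Set
NotDominated Bs As = ¬ Lex-≤ _≡_ _<_ (shape Bs) (shape As)

-- The trichotomy is stated for arbitrary expressions, so that induction on the number of factors
-- goes through; maximality and nonvanishing enter only in `outcome-maximal`.
data Outcome {k} (u : List (I k)) (As : List (Subset (suc k))) : Set where
  nested   : Linked (λ A B → B ⊆-1+ A) As → Outcome u As
  vanishes : Vanishes u → Outcome u As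
  improved : ∀ Bs → ExpressionOf u Bs → NotDominated Bs As → Outcome u As

outcome-∷ : ∀ {A B : Subset (suc k)} {As} → Nonempty A → A ⊂ ⊤ → CyclicallyDecreasing A u →
            B ⊆-1+ A → Outcome v (B ∷ As) → Outcome (v ++ u) (A ∷ B ∷ As)
outcome-∷         _  _ _  B⊆A (nested l)         = nested (B⊆A ∷ l)
outcome-∷ {u = u} _  _ _  _   (vanishes p)       = vanishes (vanishes-++ʳ u p)
outcome-∷         ne p cd _   (improved Bs e nd) = improved _ (expression-∷ ne p cd e) λ where
  -- Both shapes begin with the size of `A`, so the comparison is decided by the tails.
  (this lt)  → <-irrefl refl lt
  (tie _ lx) → nd lx

factors-expression : ∀ {As : List (Subset (suc k))} {fs} → All Nonempty As → All (_⊂ ⊤) As →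
                     Pointwise CyclicallyDecreasing As fs → ExpressionOf (product fs) As
factors-expression ne pr cds =
  record { nonempty = ne ; proper = pr ; factors = _ ; factor-d = cds ; product = refl }

outcome-step : 1 ≤ k → ∀ {A B : Subset (suc k)} {As f g fs} →
  All Nonempty (A ∷ B ∷ As) → All (_⊂ ⊤) (A ∷ B ∷ As) →
  Pointwise CyclicallyDecreasing (A ∷ B ∷ As) (f ∷ g ∷ fs) →
  Outcome (product (g ∷ fs)) (B ∷ As) → Outcome (product (f ∷ g ∷ fs)) (A ∷ B ∷ As)
outcome-step 1≤k {A} {B} {f = f} {g} {fs} (neA ∷ neB ∷ ne) (prA ∷ prB ∷ pr) (cdA ∷ cdB ∷ cds) rest
  rewrite product-∷ f (g ∷ fs) with contained? A B
... | inj₁ B⊆A = outcome-∷ neA prA cdA B⊆A rest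
... | inj₂ (b , b∈B , nb∉A)
  rewrite product-∷ g fs
  with improve (decreasing cdB) (decreasing cdA) (obstruction z∉g b∈g nb∉f)
  where
  z∉g = proj₂ (proj₂ (proj₂ prB)) ∘ Equivalence.to (CyclicallyDecreasing.letters cdB _)
  b∈g = Equivalence.from (CyclicallyDecreasing.letters cdB b) b∈B
  nb∉f = nb∉A ∘ Equivalence.to (CyclicallyDecreasing.letters cdA (next b))
... | inj₁ p = vanishes (subst Vanishes (≡.sym (++-assoc (product fs) g f)) (vanishes-++ˡ (product fs) p))
... | inj₂ imp with expression-improve 1≤k prA prB cdA cdB imp (factors-expression ne pr cds)
-- The first entry of the shape has grown, which settles the comparison whatever follows, even if a
-- factor has been dropped.
... | A′ , Ds , A<A′ , e = improved (A′ ∷ Ds) e λ where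
  (this lt)  → <-irrefl refl (<-trans lt A<A′)
  (tie eq _) → <-irrefl (≡.sym eq) A<A′

outcome : 1 ≤ k → ∀ {As : List (Subset (suc k))} {fs} → All Nonempty As → All (_⊂ ⊤) As →
          Pointwise CyclicallyDecreasing As fs → Outcome (product fs) As
outcome _   [] _ []             = nested []
outcome _   (_ ∷ []) _ (_ ∷ []) = nested [-]
outcome 1≤k ne@(_ ∷ ne′@(_ ∷ _)) pr@(_ ∷ pr′) cds@(_ ∷ cds′@(_ ∷ _)) =
  outcome-step 1≤k ne pr cds (outcome 1≤k ne′ pr′ cds′)

outcome-maximal : ∀ {u : List (I k)} {As} → ¬ Vanishes u →
                  (∀ Bs → ExpressionOf u Bs → Lex-≤ _≡_ _<_ (shape Bs) (shape As)) →
                  Outcome u As → Linked (λ A B → B ⊆-1+ A) As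
outcome-maximal _  _   (nested l)         = l
outcome-maximal nz _   (vanishes p)       = contradiction p nz
outcome-maximal _  max (improved Bs e nd) = contradiction (max Bs e) nd

proposition27 : (k : ℕ) → 1 ≤ k →
    (w : Word k) → w ≉𝟘 →
    (As : List (Subset (suc k))) → IsMaximalExpression w As →
    Linked (λ Aᵢ Aᵢ₊₁ → (_∈ Aᵢ₊₁) ⊆ shift Aᵢ) As × IsPartition (shape As)
proposition27 k 1≤k w w≉𝟘 As record { isExpression = e ; maximal = max } =
    Linked-map (λ B⊆A {i} i∈B → next i , B⊆A i i∈B , ≡.sym (prev-next i)) chain
  , All-map⁺ (All-map (λ { (_ , i∈A) → ≤-trans (s≤s z≤n) (x∈p⇒∣p-x∣<∣p∣ i∈A) }) nonempty)
  -- Sizes decrease weakly because `next` injects each subset into the one before it.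
  , Linked-map⁺ (Linked-map (λ {A} {B} B⊆A → ∣∣-injection next next-injective B A (λ {i} → B⊆A i)) chain)
  where
  open IsExpression e renaming (product to w≈)
  chain : Linked (λ A B → B ⊆-1+ A) As
  chain = outcome-maximal (w≉𝟘 ∘ trans w≈) (λ Bs e′ → max Bs (expression-resp w≈ e′))
    (outcome 1≤k nonempty proper factor-d)
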